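{- Let $C_{(=,\neq)}(x,y)$ be the bivariate generating function of the Catalan words avoiding the ordered pair of relations $(=,\neq)$, where $x$ marks the length and $y$ marks the number of descents. Then $$C_{(=,\neq)}(x,y)=\frac{1 - x + 2 x y - 2 x^2 y - \sqrt{1 - 2 x + x^2 - 4 x^2 y}}{2 x y (1 - x)}.$$
   Context: A Catalan word of length $n$ is a word $w=w_1w_2\cdots w_n$ over the non-negative integers with $w_1=0$ and $0\leq w_i\leq w_{i-1}+1$ for $i=2,\dots,n$; the empty word is the unique Catalan word of length $0$. For relations $X,Y\in\{<,>,\leq,\geq,=,\neq\}$, a word $w$ contains the pattern $(X,Y)$ if there is an index $i\geq 1$ (with $i+2\le n$) such that $w_i\,X\,w_{i+1}$ and $w_{i+1}\,Y\,w_{i+2}$; otherwise $w$ avoids $(X,Y)$. The number of descents $\mathrm{des}(w)$ is the number of indices $i$ with $w_i>w_{i+1}$. The bivariate generating function is $C_{(X,Y)}(x,y)=\sum_{w}x^{|w|}y^{\mathrm{des}(w)}$, the sum being over all Catalan words $w$ (of any length $|w|\geq 0$) avoiding $(X,Y)$. Identities are between formal power series in $x$ with coefficients polynomials in $y$ (after clearing denominators); the square root of a power series with constant term $1$ is the one with constant term $1$. -}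

module Defs where

open import Algebra.Bundles using (RawRing)
open import Data.Bool.Base using (if_then_else_)
open import Data.Integer.Base as ℤ using (ℤ; 0ℤ; 1ℤ)
open import Data.List.Base
  using (List; []; _∷_; map; foldr; filter; concatMap; upTo; applyUpTo; length)
open import Data.List.Membership.Propositional using (_∈_; find; lose)
open import Data.List.Membership.Propositional.Properties
  using (∈-map⁺; ∈-map⁻; ∈-concatMap⁺; ∈-concatMap⁻; ∈-upTo⁺; ∈-upTo⁻)
open import Data.List.Properties using (∷-injective; ∷-injectiveʳ)
open import Data.List.Relation.Unary.All as All using (All)
open import Data.List.Relation.Unary.All.Properties as All using ()
open import Data.List.Relation.Unary.AllPairs as AllPairs using (AllPairs; []; _∷_)
open import Data.List.Relation.Unary.AllPairs.Properties as AllPairs using ()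
open import Data.List.Relation.Unary.Any using (here)
open import Data.List.Relation.Unary.Linked using (Linked; []; [-]; _∷_)
open import Data.List.Relation.Unary.Unique.Propositional using (Unique)
open import Data.List.Relation.Unary.Unique.Propositional.Properties as Unique using ()
open import Data.Nat.Base as ℕ using (ℕ; zero; suc; _≤_; _∸_; s≤s; s≤s⁻¹)
open import Data.Nat.Properties using (_≟_; _<?_; suc-injective)
open import Data.Product.Base using (_×_; _,_; proj₁; proj₂)
open import Data.Sum.Base using (inj₁; inj₂)
open import Level using (0ℓ)
open import Relation.Binary.Core using (Rel)
open import Relation.Binary.Definitions using (Decidable)
open import Relation.Binary.PropositionalEquality using (_≡_; _≢_; refl; sym; trans; cong)
open import Relation.Nullary.Decidable using (Dec; no; does; map′; ¬?; _×-dec_; _⊎-dec_)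
open import Relation.Nullary.Negation using (¬_)

------------------------------------------------------------------------
-- Catalan words

Word : Set
Word = List ℕ

Step : Rel ℕ 0ℓ
Step a b = b ≤ suc a

data IsCatalan : Word → Set where
  empty : IsCatalan []
  start : ∀ {w} → Linked Step (0 ∷ w) → IsCatalan (0 ∷ w)

des : Word → ℕ
des (a ∷ b ∷ w) = (if does (b <? a) then 1 else 0) ℕ.+ des (b ∷ w)
des _           = 0

data Contains (X Y : Rel ℕ 0ℓ) : Word → Set where
  here  : ∀ {a b c w} → X a b → Y b c → Contains X Y (a ∷ b ∷ c ∷ w)
  there : ∀ {a w} → Contains X Y w → Contains X Y (a ∷ w)

Avoids : (X Y : Rel ℕ 0ℓ) → Word → Set
Avoids X Y w = ¬ Contains X Y w

contains? : ∀ {X Y} → Decidable X → Decidable Y → ∀ w → Dec (Contains X Y w)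
contains? X? Y? [] = no λ ()
contains? X? Y? (a ∷ []) = no λ { (there ()) }
contains? X? Y? (a ∷ b ∷ []) = no λ { (there (there ())) }
contains? X? Y? (a ∷ b ∷ c ∷ w) = map′
  (λ { (inj₁ (p , q)) → here p q ; (inj₂ r) → there r })
  (λ { (here p q) → inj₁ (p , q) ; (there r) → inj₂ r })
  ((X? a b ×-dec Y? b c) ⊎-dec contains? X? Y? (b ∷ c ∷ w))

infix 4 _≢?_

_≢?_ : Decidable {A = ℕ} _≢_
a ≢? b = ¬? (a ≟ b)

-- All v of length n such that a ∷ v takes only Catalan steps.
extensions : ℕ → ℕ → List Word
extensions a zero    = [] ∷ []
extensions a (suc n) = concatMap (λ b → map (b ∷_) (extensions b n)) (upTo (suc (suc a)))

catalanWords : ℕ → List Word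
catalanWords zero    = [] ∷ []
catalanWords (suc n) = map (0 ∷_) (extensions 0 n)

-- catalanWords n lists each Catalan word of length n exactly once
-- (catalanWords-sound, catalanWords-complete, catalanWords-unique).

extensions-sound : ∀ a n {v} → v ∈ extensions a n → Linked Step (a ∷ v) × length v ≡ n
extensions-sound a zero    (here refl) = [-] , refl
extensions-sound a (suc n) v∈
  with b , b∈ , v∈′ ← find (∈-concatMap⁻ (λ b → map (b ∷_) (extensions b n)) {upTo (suc (suc a))} v∈)
  with u , u∈ , refl ← ∈-map⁻ (b ∷_) v∈′
  with l , eq ← extensions-sound b n u∈
  = s≤s⁻¹ (∈-upTo⁻ b∈) ∷ l , cong suc eq

extensions-complete : ∀ a n {v} → Linked Step (a ∷ v) → length v ≡ n → v ∈ extensions a n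
extensions-complete a zero    [-]      refl = here refl
extensions-complete a (suc n) (_∷_ {y = b} s l) eq =
  ∈-concatMap⁺ (λ b → map (b ∷_) (extensions b n))
    (lose (∈-upTo⁺ (s≤s s)) (∈-map⁺ (b ∷_) (extensions-complete b n l (suc-injective eq))))

extensions-unique : ∀ a n → Unique (extensions a n)
extensions-unique a zero    = All.[] ∷ []
extensions-unique a (suc n) = Unique.concat⁺
  (All.map⁺ (All.universal (λ b → Unique.map⁺ ∷-injectiveʳ (extensions-unique b n)) (upTo (suc (suc a)))))
  (AllPairs.map⁺ (AllPairs.map disjoint (Unique.upTo⁺ (suc (suc a)))))
  where
  disjoint : ∀ {b c} → b ≢ c → ∀ {v} →
             ¬ (v ∈ map (b ∷_) (extensions b n) × v ∈ map (c ∷_) (extensions c n))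
  disjoint {b} {c} b≢c (p , q)
    with _ , _ , e ← ∈-map⁻ (b ∷_) p
    with _ , _ , f ← ∈-map⁻ (c ∷_) q
    = b≢c (proj₁ (∷-injective (trans (sym e) f)))

catalanWords-sound : ∀ n {w} → w ∈ catalanWords n → IsCatalan w × length w ≡ n
catalanWords-sound zero    (here refl) = empty , refl
catalanWords-sound (suc n) w∈
  with v , v∈ , refl ← ∈-map⁻ (0 ∷_) w∈
  with l , eq ← extensions-sound 0 n v∈
  = start l , cong suc eq

catalanWords-complete : ∀ n {w} → IsCatalan w → length w ≡ n → w ∈ catalanWords n
catalanWords-complete zero    empty     eq = here refl
catalanWords-complete (suc n) (start l) eq =
  ∈-map⁺ (0 ∷_) (extensions-complete 0 n l (suc-injective eq))

catalanWords-unique : ∀ n → Unique (catalanWords n)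
catalanWords-unique zero    = All.[] ∷ []
catalanWords-unique (suc n) = Unique.map⁺ ∷-injectiveʳ (extensions-unique 0 n)

avoidingWords : ∀ {X Y} → Decidable X → Decidable Y → ℕ → List Word
avoidingWords X? Y? n = filter (λ w → ¬? (contains? X? Y? w)) (catalanWords n)

------------------------------------------------------------------------
-- The polynomial ring ℤ[y]

-- Coefficient lists, constant term first.  Trailing zeros are allowed, so
-- equality is equality of all coefficients.
Poly : Set
Poly = List ℤ

coeff : Poly → ℕ → ℤ
coeff []      _       = 0ℤ
coeff (a ∷ p) zero    = a
coeff (a ∷ p) (suc k) = coeff p k

_≈ᵖ_ : Rel Poly 0ℓ
p ≈ᵖ q = ∀ k → coeff p k ≡ coeff q k

_+ᵖ_ : Poly → Poly → Poly
[]      +ᵖ q       = q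
(a ∷ p) +ᵖ []      = a ∷ p
(a ∷ p) +ᵖ (b ∷ q) = (a ℤ.+ b) ∷ (p +ᵖ q)

_*ᵖ_ : Poly → Poly → Poly
[]      *ᵖ q = []
(a ∷ p) *ᵖ q = map (a ℤ.*_) q +ᵖ (0ℤ ∷ (p *ᵖ q))

y^_ : ℕ → Poly
y^ zero  = 1ℤ ∷ []
y^ suc k = 0ℤ ∷ y^ k

ℤ[y] : RawRing 0ℓ 0ℓ
ℤ[y] = record
  { Carrier = Poly
  ; _≈_     = _≈ᵖ_
  ; _+_     = _+ᵖ_
  ; _*_     = _*ᵖ_
  ; -_      = map (λ a → ℤ.- a)
  ; 0#      = []
  ; 1#      = 1ℤ ∷ []
  }

------------------------------------------------------------------------
-- Formal power series in x

module PowerSeries {c ℓ} (R : RawRing c ℓ) where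
  private module R = RawRing R

  sumᴿ : List R.Carrier → R.Carrier
  sumᴿ = foldr R._+_ R.0#

  constant : R.Carrier → (ℕ → R.Carrier)
  constant r zero    = r
  constant r (suc n) = R.0#

  -- f n is the coefficient of xⁿ.
  powerSeries : RawRing c ℓ
  powerSeries = record
    { Carrier = ℕ → R.Carrier
    ; _≈_     = λ f g → ∀ n → f n R.≈ g n
    ; _+_     = λ f g n → f n R.+ g n
    ; _*_     = λ f g n → sumᴿ (applyUpTo (λ i → f i R.* g (n ∸ i)) (suc n))
    ; -_      = λ f n → R.- f n
    ; 0#      = constant R.0#
    ; 1#      = constant R.1#
    }

  indeterminate : ℕ → R.Carrier
  indeterminate 1 = R.1#
  indeterminate _ = R.0#

open PowerSeries ℤ[y] public using (sumᴿ; constant; indeterminate)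

ℤ[y]⟦x⟧ : RawRing 0ℓ 0ℓ
ℤ[y]⟦x⟧ = PowerSeries.powerSeries ℤ[y]

open RawRing ℤ[y]⟦x⟧ public
  using (_≈_; _+_; _*_; -_; 0#; 1#)
  renaming (Carrier to Series)

infixl 6 _-_

_-_ : Series → Series → Series
f - g = f + (- g)

x y 2# 4# : Series
x  = indeterminate
y  = constant (y^ 1)
2# = 1# + 1#
4# = 2# + 2#

-- S is the square root of P with constant term (in x) equal to 1.
record IsSqrt (P S : Series) : Set where
  field
    constantTerm : S 0 ≈ᵖ (1ℤ ∷ [])
    square       : S * S ≈ P

-- The generating function C_(X,Y)(x,y).
C : ∀ {X Y} → Decidable X → Decidable Y → Series
C X? Y? n = sumᴿ (map (λ w → y^ des w) (avoidingWords X? Y? n))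

{-# OPTIONS --safe #-}
module Submission where

-- Once two adjacent letters of a word avoiding (=, ≠) agree, the rest of the
-- word is constant.  Let G_a(x) count the avoiding words with first letter a,
-- whose length excludes that letter.  Reading off the second letter gives
--   G_a = 1 + x (y Σ_{b<a} G_b + 1/(1 − x) + G_{a+1}),   C = 1 + x G_0.
-- With H_a = (1 − x) G_a and T_a = 1 + x y Σ_{b<a} H_b this reads
-- H_a = T_a + x H_{a+1}, and H_a = H_0 T_a holds modulo every power of x, by
-- induction on the power for all a at once.  The case a = 1 gives the quadratic
-- equation e = 1 + x e + x² y e² for e = H_0, so that (1 − x − 2 x² y e)² is the
-- discriminant (1 − x)² − 4 x² y.

open import Algebra.Bundles using (RawRing; CommutativeRing)
import Algebra.Morphism.RingMonomorphism as RingMonomorphism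
open import Algebra.Morphism.Structures using (IsRingMonomorphism)
import Algebra.Properties.Group as GroupProperties
import Algebra.Properties.Ring as RingProperties
import Algebra.Properties.Semiring.Exp as Exp
import Algebra.Solver.Ring.NaturalCoefficients.Default as NaturalCoefficients
open import Algebra.Structures using (IsCommutativeRing)
open import Data.Bool.Base using (true; false; if_then_else_)
open import Data.Integer.Base as ℤ using (0ℤ)
import Data.Integer.Properties as ℤ
open import Data.List.Base using (List; []; _∷_; _++_; map; filter; concatMap; upTo)
open import Data.List.Properties using (map-∘; upTo-∷ʳ)
open import Data.Nat.Base as ℕ using (ℕ; zero; suc; _<_; s≤s)
open import Data.Nat.Properties using (_≟_; _<?_; ≤-refl; <-irrefl; <-asym; <⇒≢; m<n⇒m<1+n)
open import Data.Product using (∃; ∃!; _×_; _,_)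
open import Function.Base using (_∘_)
open import Function.Bundles using (mk⇔)
open import Level using (0ℓ; _⊔_)
open import Relation.Binary.PropositionalEquality as ≡ using (_≡_; _≢_; ≢-sym)
import Relation.Binary.Reasoning.Setoid as ≈-Reasoning
open import Relation.Nullary.Decidable using (does; does-⇔; dec-true; dec-false; ¬?)
open import Relation.Nullary.Negation using (contradiction)
open import Defs using (module PowerSeries)

-- Isolates the one completeness property of power series that the algebra below uses, so that the
-- recurrence can be solved in any commutative ring with two marked elements, without unfolding
-- coefficients.
XAdicallySeparated : ∀ {c ℓ} (K : CommutativeRing c ℓ) → CommutativeRing.Carrier K → Set (c ⊔ ℓ)
XAdicallySeparated K x = ∀ f g → (∀ n → ∃ λ h → f ≈ g + x ^ n * h) → f ≈ g
  where
  open CommutativeRing K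
  open Exp semiring using (_^_)

-- The ring of formal power series over a commutative ring

module PowerSeriesRing {c ℓ} (R : CommutativeRing c ℓ) where
  private module R = CommutativeRing R
  open ≈-Reasoning R.setoid
  open RawRing (PowerSeries.powerSeries R.rawRing)
  open PowerSeries R.rawRing using (constant; indeterminate)
  open NaturalCoefficients R.commutativeSemiring using (solve; _:=_; _:+_; _:*_; con)

  -- The Cauchy product computes: `(f * g) (suc n)` is `f 0 R.* g (suc n)` plus `(f ∘ suc * g) n`.
  -- So this and the other product laws go by induction on the index, with the left factor replaced
  -- by its tail.
  *-cong : ∀ {f f′ g g′} → f ≈ f′ → g ≈ g′ → (f * g) ≈ (f′ * g′)
  *-cong p q zero    = R.+-congʳ (R.*-cong (p 0) (q 0))
  *-cong {f} {f′} {g} {g′} p q (suc n) =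
    R.+-cong (R.*-cong (p 0) (q (suc n))) (*-cong {f ∘ suc} {f′ ∘ suc} {g} {g′} (p ∘ suc) q n)

  -- `0#` is `constant R.0#`, which reduces only when the index is a constructor.
  0#-at : ∀ n → 0# n R.≈ R.0#
  0#-at zero    = R.refl
  0#-at (suc n) = R.refl

  zero* : ∀ {f} → (∀ n → f n R.≈ R.0#) → ∀ g n → (f * g) n R.≈ R.0#
  zero* f≈0 g zero = R.trans (R.+-identityʳ _) (R.trans (R.*-congʳ (f≈0 0)) (R.zeroˡ _))
  zero* f≈0 g (suc n) = R.trans
    (R.+-cong (R.trans (R.*-congʳ (f≈0 0)) (R.zeroˡ _)) (zero* (f≈0 ∘ suc) g n))
    (R.+-identityʳ _)

  *-identityˡ : ∀ f → (1# * f) ≈ f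
  *-identityˡ f zero    = R.trans (R.+-identityʳ _) (R.*-identityˡ _)
  *-identityˡ f (suc n) = R.trans
    (R.+-cong (R.*-identityˡ _) (zero* (λ _ → R.refl) f n)) (R.+-identityʳ _)

  distribʳ : ∀ h f g → ((f + g) * h) ≈ (f * h + g * h)
  distribʳ h f g zero =
    solve 3 (λ a b c → (a :+ b) :* c :+ con 0 := (a :* c :+ con 0) :+ (b :* c :+ con 0)) R.refl (f 0) (g 0) (h 0)
  distribʳ h f g (suc n) = begin
    (f 0 R.+ g 0) R.* h (suc n) R.+ ((f ∘ suc + g ∘ suc) * h) n
      ≈⟨ R.+-congˡ (distribʳ h (f ∘ suc) (g ∘ suc) n) ⟩
    (f 0 R.+ g 0) R.* h (suc n) R.+ ((f ∘ suc * h) n R.+ (g ∘ suc * h) n)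
      ≈⟨ solve 5 (λ a b c d e → (a :+ b) :* c :+ (d :+ e) := (a :* c :+ d) :+ (b :* c :+ e))
           R.refl (f 0) (g 0) (h (suc n)) _ _ ⟩
    (f * h + g * h) (suc n) ∎

  *-scaleˡ : ∀ r f g n → ((λ k → r R.* f k) * g) n R.≈ r R.* (f * g) n
  *-scaleˡ r f g zero = R.trans (R.+-identityʳ _)
    (R.trans (R.*-assoc _ _ _) (R.*-congˡ (R.sym (R.+-identityʳ _))))
  *-scaleˡ r f g (suc n) = R.trans
    (R.+-cong (R.*-assoc _ _ _) (*-scaleˡ r (f ∘ suc) g n)) (R.sym (R.distribˡ _ _ _))

  *-assoc : ∀ f g h → ((f * g) * h) ≈ (f * (g * h))
  *-assoc f g h zero = R.+-congʳ (begin
    (f 0 R.* g 0 R.+ R.0#) R.* h 0 ≈⟨ R.*-congʳ (R.+-identityʳ _) ⟩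
    f 0 R.* g 0 R.* h 0            ≈⟨ R.*-assoc _ _ _ ⟩
    f 0 R.* (g 0 R.* h 0)          ≈⟨ R.*-congˡ (R.+-identityʳ _) ⟨
    f 0 R.* (g 0 R.* h 0 R.+ R.0#) ∎)
  *-assoc f g h (suc n) = begin
    -- The tail of `f * g` is the tail of `g` scaled by `f 0`, plus the tail of `f` times `g`; each
    -- summand is then multiplied by `h` separately.
    (f 0 R.* g 0 R.+ R.0#) R.* h (suc n) R.+ (((λ k → f 0 R.* g (suc k)) + f ∘ suc * g) * h) n
      ≈⟨ R.+-cong (R.*-congʳ (R.+-identityʳ _)) (distribʳ h (λ k → f 0 R.* g (suc k)) (f ∘ suc * g) n) ⟩
    f 0 R.* g 0 R.* h (suc n) R.+ (((λ k → f 0 R.* g (suc k)) * h) n R.+ ((f ∘ suc * g) * h) n)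
      ≈⟨ R.+-congˡ (R.+-cong (*-scaleˡ (f 0) (g ∘ suc) h n) (*-assoc (f ∘ suc) g h n)) ⟩
    f 0 R.* g 0 R.* h (suc n) R.+ (f 0 R.* (g ∘ suc * h) n R.+ (f ∘ suc * (g * h)) n)
      ≈⟨ solve 5 (λ a b c d e → a :* b :* c :+ (a :* d :+ e) := a :* (b :* c :+ d) :+ e)
           R.refl (f 0) (g 0) (h (suc n)) _ _ ⟩
    (f * (g * h)) (suc n) ∎

  -- The product unfolds along its left factor only; commutativity also needs this unfolding along
  -- the right one.
  *-tailʳ : ∀ f g n → (f * g) (suc n) R.≈ (f * (g ∘ suc)) n R.+ f (suc n) R.* g 0
  *-tailʳ f g zero = R.trans (R.+-congˡ (R.+-identityʳ _)) (R.+-congʳ (R.sym (R.+-identityʳ _)))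
  *-tailʳ f g (suc n) = R.trans (R.+-congˡ (*-tailʳ (f ∘ suc) g n)) (R.sym (R.+-assoc _ _ _))

  *-comm : ∀ f g → (f * g) ≈ (g * f)
  *-comm f g zero    = R.+-congʳ (R.*-comm _ _)
  *-comm f g (suc n) = begin
    f 0 R.* g (suc n) R.+ (f ∘ suc * g) n   ≈⟨ R.+-cong (R.*-comm _ _) (*-comm (f ∘ suc) g n) ⟩
    g (suc n) R.* f 0 R.+ (g * (f ∘ suc)) n ≈⟨ R.+-comm _ _ ⟩
    (g * (f ∘ suc)) n R.+ g (suc n) R.* f 0 ≈⟨ *-tailʳ g f n ⟨
    (g * f) (suc n)                         ∎

  isCommutativeRing : IsCommutativeRing _≈_ _+_ _*_ -_ 0# 1#
  isCommutativeRing = record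
    { isRing = record
      { +-isAbelianGroup = record
        { isGroup = record
          { isMonoid = record
            { isSemigroup = record
              { isMagma = record
                { isEquivalence = record
                  { refl  = λ _ → R.refl
                  ; sym   = λ p n → R.sym (p n)
                  ; trans = λ p q n → R.trans (p n) (q n)
                  }
                ; ∙-cong = λ p q n → R.+-cong (p n) (q n)
                }
              ; assoc = λ f g h n → R.+-assoc (f n) (g n) (h n)
              }
            ; identity = (λ f n → R.trans (R.+-congʳ (0#-at n)) (R.+-identityˡ (f n)))
                       , (λ f n → R.trans (R.+-congˡ (0#-at n)) (R.+-identityʳ (f n)))
            }
          ; inverse = (λ f n → R.trans (R.-‿inverseˡ (f n)) (R.sym (0#-at n)))
                    , (λ f n → R.trans (R.-‿inverseʳ (f n)) (R.sym (0#-at n)))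
          ; ⁻¹-cong = λ p n → R.-‿cong (p n)
          }
        ; comm = λ f g n → R.+-comm (f n) (g n)
        }
      ; *-cong     = *-cong
      ; *-assoc    = *-assoc
      ; *-identity = *-identityˡ , λ f n → R.trans (*-comm f 1# n) (*-identityˡ f n)
      ; distrib    = (λ f g h n → R.trans (*-comm f (g + h) n) (R.trans (distribʳ f g h n)
                       (R.+-cong (*-comm g f n) (*-comm h f n))))
                   , distribʳ
      }
    ; *-comm = *-comm
    }

  commutativeRing : CommutativeRing c ℓ
  commutativeRing = record { isCommutativeRing = isCommutativeRing }

  constant* : ∀ r f n → (constant r * f) n R.≈ r R.* f n
  constant* r f zero    = R.+-identityʳ _
  constant* r f (suc n) = R.trans (R.+-congˡ (zero* (λ _ → R.refl) f n)) (R.+-identityʳ _)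

  indeterminate*-zero : ∀ f → (indeterminate * f) 0 R.≈ R.0#
  indeterminate*-zero f = R.trans (R.+-identityʳ _) (R.zeroˡ _)

  indeterminate*-suc : ∀ f n → (indeterminate * f) (suc n) R.≈ f n
  indeterminate*-suc f n = begin
    R.0# R.* f (suc n) R.+ (indeterminate ∘ suc * f) n ≈⟨ R.+-cong (R.zeroˡ _) (*-cong {f = indeterminate ∘ suc} {g = f} tail≈1 (λ _ → R.refl) n) ⟩
    R.0# R.+ (1# * f) n                                ≈⟨ R.+-identityˡ _ ⟩
    (1# * f) n                                         ≈⟨ *-identityˡ f n ⟩
    f n                                                ∎
    where
    tail≈1 : ∀ n → indeterminate (suc n) R.≈ 1# n
    tail≈1 zero    = R.refl
    tail≈1 (suc _) = R.refl


  open Exp (CommutativeRing.semiring commutativeRing) using (_^_)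

  indeterminate^*-zero : ∀ m h {k} → k < m → ((indeterminate ^ m) * h) k R.≈ R.0#
  indeterminate^*-zero (suc m) h {k} k<m = R.trans (*-assoc indeterminate (indeterminate ^ m) h k) (lower k<m)
    where
    lower : ∀ {k} → k < suc m → (indeterminate * ((indeterminate ^ m) * h)) k R.≈ R.0#
    lower {zero}  _         = indeterminate*-zero ((indeterminate ^ m) * h)
    lower {suc k} (s≤s k<m) = R.trans (indeterminate*-suc ((indeterminate ^ m) * h) k) (indeterminate^*-zero m h k<m)

  x-adically-separated : XAdicallySeparated commutativeRing indeterminate
  -- A congruence modulo the power n + 1 already fixes coefficient n, because the remainder starts
  -- at degree n + 1.
  x-adically-separated f g congruent n with h , f≈ ← congruent (suc n) =
    R.trans (f≈ n) (R.trans (R.+-congˡ (indeterminate^*-zero (suc n) h ≤-refl)) (R.+-identityʳ _))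

  -- The lowest coefficient of `d * u` is `d 0 R.* u 0`, so regularity of `u 0` kills `d 0`. The
  -- tail of `d` then also annihilates `u`, and the argument repeats.
  nonZeroDivisor : ∀ {u} → (∀ r → r R.* u 0 R.≈ R.0# → r R.≈ R.0#) →
                   ∀ d → (∀ n → (d * u) n R.≈ R.0#) → ∀ n → d n R.≈ R.0#
  nonZeroDivisor {u} regular d du≈0 = λ { zero → d₀≈0 ; (suc n) → nonZeroDivisor {u} regular (d ∘ suc) tail≈0 n }
    where
    d₀≈0 : d 0 R.≈ R.0#
    d₀≈0 = regular (d 0) (R.trans (R.sym (R.+-identityʳ _)) (du≈0 0))
    tail≈0 : ∀ n → (d ∘ suc * u) n R.≈ R.0#
    tail≈0 n = begin
      (d ∘ suc * u) n                          ≈⟨ R.+-identityˡ _ ⟨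
      R.0# R.+ (d ∘ suc * u) n                 ≈⟨ R.+-congʳ (R.trans (R.*-congʳ d₀≈0) (R.zeroˡ _)) ⟨
      d 0 R.* u (suc n) R.+ (d ∘ suc * u) n    ≈⟨ du≈0 (suc n) ⟩
      R.0#                                     ∎

-- Solving the recurrence in a commutative ring

module KernelMethod {c ℓ} (K : CommutativeRing c ℓ) (x y : CommutativeRing.Carrier K)
  (x-adically-separated : XAdicallySeparated K x) where
  open CommutativeRing K
  open Exp semiring using (_^_)
  open ≈-Reasoning setoid
  open RingProperties ring
  open NaturalCoefficients commutativeSemiring using (solve; _:=_; _:+_; _:*_; con)

  -- Symmetry of congruence modulo `p`; it allows H_0 T_1 to be replaced by H_1 below.
  flip-remainder : ∀ {f g p h} → f ≈ g + p * h → g ≈ f + p * - h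
  flip-remainder {f} {g} {p} {h} f≈ = begin
    g                       ≈⟨ +-identityʳ g ⟨
    g + 0#                  ≈⟨ +-congˡ (zeroʳ p) ⟨
    g + p * 0#              ≈⟨ +-congˡ (*-congˡ (-‿inverseʳ h)) ⟨
    g + p * (h + - h)       ≈⟨ solve 4 (λ g p h h′ → g :+ p :* (h :+ h′) := g :+ p :* h :+ p :* h′) refl g p h (- h) ⟩
    g + p * h + p * - h     ≈⟨ +-congʳ f≈ ⟨
    f + p * - h             ∎

  module _ (H T : ℕ → Carrier)
           (T-zero : T 0 ≈ 1#)
           (T-suc  : ∀ a → T (suc a) ≈ T a + x * y * H a)
           (H-step : ∀ a → H a ≈ T a + x * H (suc a))
    where

    T-one : T 1 ≈ 1# + x * y * H 0
    T-one = trans (T-suc 0) (+-congʳ T-zero)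

    -- Up to remainders, H_0 T_{a+1} = H_0 (T_a + x y H_0 T_a) = H_0 T_1 T_a = H_1 T_a. Hence H_a =
    -- T_a + x H_{a+1} becomes (1 + x H_1) T_a = H_0 T_a. The factor x in front of H_{a+1} raises
    -- the modulus by one.
    factorises-mod : ∀ n a → ∃ λ h → H a ≈ H 0 * T a + x ^ n * h
    factorises-mod zero    a = H a + - (H 0 * T a) , (begin
      H a                                      ≈⟨ +-identityˡ (H a) ⟨
      0# + H a                                 ≈⟨ +-congʳ (-‿inverseʳ (H 0 * T a)) ⟨
      H 0 * T a + - (H 0 * T a) + H a
        ≈⟨ solve 3 (λ u v w → u :+ v :+ w := u :+ con 1 :* (w :+ v)) refl (H 0 * T a) (- (H 0 * T a)) (H a) ⟩
      H 0 * T a + 1# * (H a + - (H 0 * T a))   ∎)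
    factorises-mod (suc n) a
      with h , eq ← factorises-mod n a
      with i , eq-suc ← factorises-mod n (suc a)
      with j , eq-one ← factorises-mod n 1
      -- The three summands are the errors from replacing H_0 T_1 by H_1, H_a by H_0 T_a inside
      -- `T (suc a)`, and H_{a+1} by H_0 T_{a+1}.
      = (- j * T a + x * y * H 0 * h + i) , (begin
      H a
        ≈⟨ H-step a ⟩
      T a + x * H (suc a)
        ≈⟨ +-congˡ (*-congˡ eq-suc) ⟩
      T a + x * (H 0 * T (suc a) + p * i)
        ≈⟨ +-congˡ (*-congˡ (+-congʳ (*-congˡ (T-suc a)))) ⟩
      T a + x * (H 0 * (T a + x * y * H a) + p * i)
        ≈⟨ +-congˡ (*-congˡ (+-congʳ (*-congˡ (+-congˡ (*-congˡ eq))))) ⟩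
      T a + x * (H 0 * (T a + x * y * (H 0 * T a + p * h)) + p * i)
        ≈⟨ solve 7 (λ x y h₀ t p h i →
             t :+ x :* (h₀ :* (t :+ x :* y :* (h₀ :* t :+ p :* h)) :+ p :* i)
             := t :+ x :* (h₀ :* (con 1 :+ x :* y :* h₀) :* t :+ p :* (x :* y :* h₀ :* h :+ i)))
             refl x y (H 0) (T a) p h i ⟩
      T a + x * (H 0 * (1# + x * y * H 0) * T a + p * (x * y * H 0 * h + i))
        ≈⟨ +-congˡ (*-congˡ (+-congʳ (*-congʳ (*-congˡ T-one)))) ⟨
      T a + x * (H 0 * T 1 * T a + p * (x * y * H 0 * h + i))
        ≈⟨ +-congˡ (*-congˡ (+-congʳ (*-congʳ (flip-remainder eq-one)))) ⟩
      T a + x * ((H 1 + p * - j) * T a + p * (x * y * H 0 * h + i))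
        ≈⟨ solve 9 (λ x y h₀ t p h i h₁ j →
             t :+ x :* ((h₁ :+ p :* j) :* t :+ p :* (x :* y :* h₀ :* h :+ i))
             := (con 1 :+ x :* h₁) :* t :+ x :* p :* (j :* t :+ x :* y :* h₀ :* h :+ i))
             refl x y (H 0) (T a) p h i (H 1) (- j) ⟩
      (1# + x * H 1) * T a + x * p * (- j * T a + x * y * H 0 * h + i)
        ≈⟨ +-congʳ (*-congʳ (+-congʳ T-zero)) ⟨
      (T 0 + x * H 1) * T a + x * p * (- j * T a + x * y * H 0 * h + i)
        ≈⟨ +-congʳ (*-congʳ (H-step 0)) ⟨
      H 0 * T a + x * p * (- j * T a + x * y * H 0 * h + i)
        ∎)
      where p = x ^ n

    quadratic : H 0 ≈ 1# + x * H 0 + x * x * y * H 0 * H 0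
    quadratic = begin
      H 0                               ≈⟨ H-step 0 ⟩
      -- The congruences at a = 1, holding for every power of `x`, become an equality by separation.
      T 0 + x * H 1                     ≈⟨ +-cong T-zero (*-congˡ (x-adically-separated (H 1) (H 0 * T 1) (λ n → factorises-mod n 1))) ⟩
      1# + x * (H 0 * T 1)              ≈⟨ +-congˡ (*-congˡ (*-congˡ T-one)) ⟩
      1# + x * (H 0 * (1# + x * y * H 0))
        ≈⟨ solve 3 (λ x y h → con 1 :+ x :* (h :* (con 1 :+ x :* y :* h))
             := con 1 :+ x :* h :+ x :* x :* y :* h :* h) refl x y (H 0) ⟩
      1# + x * H 0 + x * x * y * H 0 * H 0 ∎

  private
    x′ 2# 4# : Carrier
    x′ = - x
    2# = 1# + 1#
    4# = 2# + 2#

  -- The semiring solver does not relate `x′` to `x`, so each cancellation is first gathered into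
  -- one multiple of `x + x′` and then removed here.
  x+x′-absorb : ∀ u v → u + (x + x′) * v ≈ u
  x+x′-absorb u v = begin
    u + (x + x′) * v ≈⟨ +-congˡ (*-congʳ (-‿inverseʳ x)) ⟩
    u + 0# * v       ≈⟨ +-congˡ (zeroˡ v) ⟩
    u + 0#           ≈⟨ +-identityʳ u ⟩
    u                ∎

  x′x′≈xx : x′ * x′ ≈ x * x
  x′x′≈xx = begin
    - x * - x   ≈⟨ -‿distribˡ-* x (- x) ⟨
    - (x * - x) ≈⟨ -‿cong (-‿distribʳ-* x x) ⟨
    - - (x * x) ≈⟨ -‿involutive (x * x) ⟩
    x * x       ∎

  -- 1 − x − 2x²ye, with −x kept as the atom x′ so that the semiring solver applies.
  discriminant-root : Carrier → Carrier
  discriminant-root e = 1# + x′ + 2# * (x * x′ * y * e)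

  -- Squaring gives (1 - x)² - 4 x² y (e - x e - x² y e²), and the quadratic equation for e says
  -- that the bracket is 1.
  discriminant-square : ∀ e → e ≈ 1# + x * e + x * x * y * e * e →
    discriminant-root e * discriminant-root e ≈ 1# - 2# * x + x * x - 4# * (x * x) * y
  discriminant-square e e-quadratic = begin
    discriminant-root e * discriminant-root e
      ≈⟨ solve 4 (λ x x′ y e →
           (con 1 :+ x′ :+ con 2 :* (x :* x′ :* y :* e)) :* (con 1 :+ x′ :+ con 2 :* (x :* x′ :* y :* e))
           := con 1 :+ con 2 :* x′ :+ x′ :* x′ :+ con 4 :* (x :* x′ :* y) :* (e :+ x′ :* e :+ x :* x′ :* y :* e :* e))
           refl x x′ y e ⟩
    -- The coefficient `2# + 1# + 1#` is the solver's left-nested reading of `con 4`; it is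
    -- regrouped as `4#` two steps later.
    1# + 2# * x′ + x′ * x′ + (2# + 1# + 1#) * (x * x′ * y) * (e + x′ * e + x * x′ * y * e * e)
      ≈⟨ +-cong (+-congˡ x′x′≈xx) (*-congˡ bracket≈1) ⟩
    1# + 2# * x′ + x * x + (2# + 1# + 1#) * (x * x′ * y) * 1#
      ≈⟨ solve 3 (λ x x′ y → con 1 :+ con 2 :* x′ :+ x :* x :+ con 4 :* (x :* x′ :* y) :* con 1
           := con 1 :+ con 2 :* x′ :+ x :* x :+ (con 2 :+ con 2) :* (x :* x′) :* y) refl x x′ y ⟩
    1# + 2# * x′ + x * x + 4# * (x * x′) * y
      ≈⟨ +-cong (+-congʳ (+-congˡ (-‿distribʳ-* 2# x))) -4xxy ⟨
    1# - 2# * x + x * x - 4# * (x * x) * y ∎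
    where
    bracket≈1 : e + x′ * e + x * x′ * y * e * e ≈ 1#
    bracket≈1 = begin
      e + x′ * e + x * x′ * y * e * e
        ≈⟨ +-congʳ (+-congʳ e-quadratic) ⟩
      1# + x * e + x * x * y * e * e + x′ * e + x * x′ * y * e * e
        ≈⟨ solve 4 (λ x x′ y e → con 1 :+ x :* e :+ x :* x :* y :* e :* e :+ x′ :* e :+ x :* x′ :* y :* e :* e
             := con 1 :+ (x :+ x′) :* (e :+ x :* y :* e :* e)) refl x x′ y e ⟩
      1# + (x + x′) * (e + x * y * e * e)
        ≈⟨ x+x′-absorb 1# _ ⟩
      1# ∎
    -4xxy : - (4# * (x * x) * y) ≈ 4# * (x * x′) * y
    -4xxy = begin
      - (4# * (x * x) * y) ≈⟨ -‿distribˡ-* (4# * (x * x)) y ⟩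
      - (4# * (x * x)) * y ≈⟨ *-congʳ (-‿distribʳ-* 4# (x * x)) ⟩
      4# * - (x * x) * y   ≈⟨ *-congʳ (*-congˡ (-‿distribʳ-* x x)) ⟩
      4# * (x * x′) * y    ∎

  module Solution
    (G Σ : ℕ → Carrier) (geometric C : Carrier)
    (geometric-eq : geometric ≈ 1# + x * geometric)
    (Σ-zero : Σ 0 ≈ 0#)
    (Σ-suc  : ∀ a → Σ (suc a) ≈ Σ a + G a)
    (G-step : ∀ a → G a ≈ 1# + x * (y * Σ a + (geometric + G (suc a))))
    (C-eq   : C ≈ 1# + x * G 0)
    where

    H T : ℕ → Carrier
    H a = (1# + x′) * G a
    T a = 1# + x * y * (1# + x′) * Σ a

    -- Since `geometric` is 1/(1 - x), the factor 1 - x turns 1 + x/(1 - x) into 1; this clears the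
    -- only non-polynomial term of the recurrence.
    H-step : ∀ a → H a ≈ T a + x * H (suc a)
    H-step a = begin
      (1# + x′) * G a
        ≈⟨ *-congˡ (G-step a) ⟩
      (1# + x′) * (1# + x * (y * Σ a + (geometric + G (suc a))))
        ≈⟨ solve 6 (λ x x′ y s o g → (con 1 :+ x′) :* (con 1 :+ x :* (y :* s :+ (o :+ g)))
             := x′ :+ x :* (o :+ x′ :* o) :+ (con 1 :+ x :* y :* (con 1 :+ x′) :* s :+ x :* ((con 1 :+ x′) :* g)))
             refl x x′ y (Σ a) geometric (G (suc a)) ⟩
      x′ + x * (geometric + x′ * geometric) + (T a + x * H (suc a))
        -- Unfolding only the first `geometric` makes everything apart from T_a + x H_{a+1} a
        -- multiple of `x + x′`.
        ≈⟨ +-congʳ (+-congˡ (*-congˡ (+-congʳ geometric-eq))) ⟩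
      x′ + x * (1# + x * geometric + x′ * geometric) + (T a + x * H (suc a))
        ≈⟨ solve 4 (λ x x′ o r → x′ :+ x :* (con 1 :+ x :* o :+ x′ :* o) :+ r := r :+ (x :+ x′) :* (con 1 :+ x :* o))
             refl x x′ geometric _ ⟩
      T a + x * H (suc a) + (x + x′) * (1# + x * geometric)
        ≈⟨ x+x′-absorb _ _ ⟩
      T a + x * H (suc a) ∎

    T-zero : T 0 ≈ 1#
    T-zero = trans (+-congˡ (trans (*-congˡ Σ-zero) (zeroʳ _))) (+-identityʳ 1#)

    T-suc : ∀ a → T (suc a) ≈ T a + x * y * H a
    T-suc a = begin
      1# + x * y * (1# + x′) * Σ (suc a)   ≈⟨ +-congˡ (*-congˡ (Σ-suc a)) ⟩
      1# + x * y * (1# + x′) * (Σ a + G a)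
        ≈⟨ solve 5 (λ x x′ y s g → con 1 :+ x :* y :* (con 1 :+ x′) :* (s :+ g)
             := con 1 :+ x :* y :* (con 1 :+ x′) :* s :+ x :* y :* ((con 1 :+ x′) :* g)) refl x x′ y (Σ a) (G a) ⟩
      T a + x * y * H a                    ∎

    root : Carrier
    root = discriminant-root (H 0)

    root-square : root * root ≈ 1# - 2# * x + x * x - 4# * (x * x) * y
    root-square = discriminant-square (H 0) (quadratic H T T-zero T-suc H-step)

    -- On the left, G_0 occurs only in 2 x² y (1 - x) G_0 = 2 x² y H_0, which is exactly what `root`
    -- subtracts. So the left side plus `root` is free of G_0 and is the rational part of the
    -- numerator.
    closed-form : ∀ s → root ≈ s →
                  (2# * x * y * (1# - x)) * C ≈ 1# - x + 2# * x * y - 2# * (x * x) * y - s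
    closed-form s root≈s = begin
      L                                                 ≈⟨ +-identityʳ L ⟨
      L + 0#                                            ≈⟨ +-congˡ (-‿inverseʳ root) ⟨
      L + (root + - root)                               ≈⟨ +-assoc _ _ _ ⟨
      L + root + - root                                 ≈⟨ +-cong L+root (-‿cong root≈s) ⟩
      1# - x + 2# * x * y - 2# * (x * x) * y - s        ∎
      where
      L = (2# * x * y * (1# - x)) * C
      -2xxy : - (2# * (x * x) * y) ≈ 2# * (x * x′) * y
      -2xxy = begin
        - (2# * (x * x) * y) ≈⟨ -‿distribˡ-* (2# * (x * x)) y ⟩
        - (2# * (x * x)) * y ≈⟨ *-congʳ (-‿distribʳ-* 2# (x * x)) ⟩
        2# * - (x * x) * y   ≈⟨ *-congʳ (*-congˡ (-‿distribʳ-* x x)) ⟩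
        2# * (x * x′) * y    ∎
      L+root : L + root ≈ 1# - x + 2# * x * y - 2# * (x * x) * y
      L+root = begin
        L + root ≈⟨ +-congʳ (*-congˡ C-eq) ⟩
        2# * x * y * (1# + x′) * (1# + x * G 0) + (1# + x′ + 2# * (x * x′ * y * H 0))
          ≈⟨ solve 4 (λ x x′ y g →
               con 2 :* x :* y :* (con 1 :+ x′) :* (con 1 :+ x :* g)
                 :+ (con 1 :+ x′ :+ con 2 :* (x :* x′ :* y :* ((con 1 :+ x′) :* g)))
               := con 1 :+ x′ :+ con 2 :* x :* y :+ con 2 :* (x :* x′) :* y
                 :+ (x :+ x′) :* (con 2 :* x :* y :* (con 1 :+ x′) :* g)) refl x x′ y (G 0) ⟩
        1# + x′ + 2# * x * y + 2# * (x * x′) * y + (x + x′) * (2# * x * y * (1# + x′) * G 0)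
          ≈⟨ x+x′-absorb _ _ ⟩
        1# + x′ + 2# * x * y + 2# * (x * x′) * y
          ≈⟨ +-congˡ -2xxy ⟨
        1# - x + 2# * x * y - 2# * (x * x) * y ∎

module _ {c ℓ} (K : CommutativeRing c ℓ) where
  open CommutativeRing K
  open ≈-Reasoning setoid
  open RingProperties ring

  -- Prepares the uniqueness of square roots, where the factor `s + t` is cancelled.
  difference-of-squares : ∀ s t → s * s ≈ t * t → (s - t) * (s + t) ≈ 0#
  difference-of-squares s t s²≈t² = begin
    (s - t) * (s + t)                     ≈⟨ distribˡ (s - t) s t ⟩
    (s - t) * s + (s - t) * t             ≈⟨ +-cong ([y-z]x≈yx-zx s s t) ([y-z]x≈yx-zx t s t) ⟩
    (s * s - t * s) + (s * t - t * t)     ≈⟨ +-cong (+-congˡ (-‿cong (*-comm t s))) (+-congˡ (-‿cong (sym s²≈t²))) ⟩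
    (s * s - s * t) + (s * t - s * s)     ≈⟨ +-congʳ (⁻¹-anti-homo‿- (s * t) (s * s)) ⟨
    - (s * t - s * s) + (s * t - s * s)   ≈⟨ -‿inverseˡ _ ⟩
    0#                                    ∎

open import Defs

-- Polynomials in y inside power series in y

coeff-+ᵖ : ∀ p q k → coeff (p +ᵖ q) k ≡ coeff p k ℤ.+ coeff q k
coeff-+ᵖ []      q       k       = ≡.sym (ℤ.+-identityˡ _)
coeff-+ᵖ (a ∷ p) []      k       = ≡.sym (ℤ.+-identityʳ _)
coeff-+ᵖ (a ∷ p) (b ∷ q) zero    = ≡.refl
coeff-+ᵖ (a ∷ p) (b ∷ q) (suc k) = coeff-+ᵖ p q k

coeff-map : ∀ {f} → f 0ℤ ≡ 0ℤ → ∀ p k → coeff (map f p) k ≡ f (coeff p k)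
coeff-map f0 []      k       = ≡.sym f0
coeff-map f0 (a ∷ p) zero    = ≡.refl
coeff-map f0 (a ∷ p) (suc k) = coeff-map f0 p k

private
  module ℤ⟦y⟧ = RawRing (PowerSeries.powerSeries (CommutativeRing.rawRing ℤ.+-*-commutativeRing))
  module ℤ⟦y⟧-ring = PowerSeriesRing ℤ.+-*-commutativeRing

-- Both products recurse on the left factor: the head scales `q`, and the tail contributes one
-- degree higher.
coeff-*ᵖ : ∀ p q → coeff (p *ᵖ q) ℤ⟦y⟧.≈ (coeff p ℤ⟦y⟧.* coeff q)
coeff-*ᵖ []      q k = ≡.sym (ℤ⟦y⟧-ring.zero* (λ _ → ≡.refl) (coeff q) k)
coeff-*ᵖ (a ∷ p) q k = ≡.trans (coeff-+ᵖ (map (a ℤ.*_) q) (0ℤ ∷ (p *ᵖ q)) k)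
  (≡.trans (≡.cong (ℤ._+ coeff (0ℤ ∷ (p *ᵖ q)) k) (coeff-map (ℤ.*-zeroʳ a) q k)) (shifted k))
  where
  shifted : ∀ k → a ℤ.* coeff q k ℤ.+ coeff (0ℤ ∷ (p *ᵖ q)) k
                ≡ (coeff (a ∷ p) ℤ⟦y⟧.* coeff q) k
  shifted zero    = ≡.refl
  shifted (suc k) = ≡.cong (λ c → a ℤ.* coeff q (suc k) ℤ.+ c) (coeff-*ᵖ p q k)

-- Equality of polynomials is by definition equality of coefficients, so injectivity is immediate
-- and the ring laws of `ℤ[y]` are inherited from power series over the integers.
coeff-isRingMonomorphism : IsRingMonomorphism ℤ[y] (PowerSeries.powerSeries (CommutativeRing.rawRing ℤ.+-*-commutativeRing)) coeff
coeff-isRingMonomorphism = record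
  { isRingHomomorphism = record
    { isSemiringHomomorphism = record
      { isNearSemiringHomomorphism = record
        { +-isMonoidHomomorphism = record
          { isMagmaHomomorphism = record
            { isRelHomomorphism = record { cong = λ p≈q → p≈q }
            ; homo              = coeff-+ᵖ
            }
          ; ε-homo = λ { zero → ≡.refl ; (suc _) → ≡.refl }
          }
        ; *-homo = coeff-*ᵖ
        }
      ; 1#-homo = λ { zero → ≡.refl ; (suc _) → ≡.refl }
      }
    ; -‿homo = coeff-map ≡.refl
    }
  ; injective = λ p≈q → p≈q
  }

ℤ[y]-commutativeRing : CommutativeRing 0ℓ 0ℓ
ℤ[y]-commutativeRing = record
  { isCommutativeRing = RingMonomorphism.isCommutativeRing coeff-isRingMonomorphism ℤ⟦y⟧-ring.isCommutativeRing }

private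
  module 𝕡 = CommutativeRing ℤ[y]-commutativeRing

-- Finite sums of polynomials

∑ : ∀ {A : Set} → List A → (A → Poly) → Poly
∑ as f = sumᴿ (map f as)

∑-++ : ∀ {A : Set} (as bs : List A) f → ∑ (as ++ bs) f 𝕡.≈ (∑ as f 𝕡.+ ∑ bs f)
∑-++ []       bs f = 𝕡.refl {∑ bs f}
∑-++ (a ∷ as) bs f = begin
  f a 𝕡.+ ∑ (as ++ bs) f           ≈⟨ 𝕡.+-congˡ {f a} (∑-++ as bs f) ⟩
  f a 𝕡.+ (∑ as f 𝕡.+ ∑ bs f)      ≈⟨ 𝕡.+-assoc (f a) (∑ as f) (∑ bs f) ⟨
  f a 𝕡.+ ∑ as f 𝕡.+ ∑ bs f        ∎
  where open ≈-Reasoning 𝕡.setoid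

∑-cong : ∀ {A : Set} (as : List A) {f g} → (∀ a → f a 𝕡.≈ g a) → ∑ as f 𝕡.≈ ∑ as g
∑-cong []       f≈g = 𝕡.refl {[]}
∑-cong (a ∷ as) {f} {g} f≈g = 𝕡.+-cong {f a} {g a} {∑ as f} {∑ as g} (f≈g a) (∑-cong as f≈g)

∑-*ˡ : ∀ {A : Set} r (as : List A) f → ∑ as (λ a → r 𝕡.* f a) 𝕡.≈ (r 𝕡.* ∑ as f)
∑-*ˡ r []       f = 𝕡.sym {r 𝕡.* []} {[]} (𝕡.zeroʳ r)
∑-*ˡ r (a ∷ as) f = begin
  r 𝕡.* f a 𝕡.+ ∑ as (λ a → r 𝕡.* f a) ≈⟨ 𝕡.+-congˡ {r 𝕡.* f a} (∑-*ˡ r as f) ⟩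
  r 𝕡.* f a 𝕡.+ r 𝕡.* ∑ as f           ≈⟨ 𝕡.distribˡ r (f a) (∑ as f) ⟨
  r 𝕡.* (f a 𝕡.+ ∑ as f)               ∎
  where open ≈-Reasoning 𝕡.setoid

∑-zero : ∀ {A : Set} (as : List A) {f} → (∀ a → f a 𝕡.≈ []) → ∑ as f 𝕡.≈ []
∑-zero []       f≈0 = 𝕡.refl {[]}
∑-zero (a ∷ as) {f} f≈0 = 𝕡.+-cong {f a} {[]} {∑ as f} {[]} (f≈0 a) (∑-zero as f≈0)

∑-upTo-suc : ∀ m f → ∑ (upTo (suc m)) f 𝕡.≈ (∑ (upTo m) f 𝕡.+ f m)
∑-upTo-suc m f = begin
  ∑ (upTo (suc m)) f           ≡⟨ ≡.cong (λ bs → ∑ bs f) (upTo-∷ʳ m) ⟨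
  ∑ (upTo m ++ m ∷ []) f       ≈⟨ ∑-++ (upTo m) (m ∷ []) f ⟩
  ∑ (upTo m) f 𝕡.+ (f m 𝕡.+ [])  ≈⟨ 𝕡.+-congˡ {∑ (upTo m) f} (𝕡.+-identityʳ (f m)) ⟩
  ∑ (upTo m) f 𝕡.+ f m         ∎
  where open ≈-Reasoning 𝕡.setoid

∑-upTo-cong : ∀ m {f g} → (∀ b → b < m → f b 𝕡.≈ g b) → ∑ (upTo m) f 𝕡.≈ ∑ (upTo m) g
∑-upTo-cong zero    f≈g = 𝕡.refl {[]}
∑-upTo-cong (suc m) {f} {g} f≈g = begin
  ∑ (upTo (suc m)) f       ≈⟨ ∑-upTo-suc m f ⟩
  ∑ (upTo m) f 𝕡.+ f m     ≈⟨ 𝕡.+-cong {∑ (upTo m) f} {∑ (upTo m) g} {f m} {g m}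
                                (∑-upTo-cong m (λ b b<m → f≈g b (m<n⇒m<1+n b<m))) (f≈g m ≤-refl) ⟩
  ∑ (upTo m) g 𝕡.+ g m     ≈⟨ ∑-upTo-suc m g ⟨
  ∑ (upTo (suc m)) g       ∎
  where open ≈-Reasoning 𝕡.setoid

-- Words, pattern avoidance and descents

∑-extensions : ∀ a n f → ∑ (extensions a (suc n)) f
             𝕡.≈ ∑ (upTo (2 ℕ.+ a)) (λ b → ∑ (extensions b n) (λ v → f (b ∷ v)))
∑-extensions a n f = go (upTo (2 ℕ.+ a))
  where
  go : ∀ bs → ∑ (concatMap (λ b → map (b ∷_) (extensions b n)) bs) f
        𝕡.≈ ∑ bs (λ b → ∑ (extensions b n) (λ v → f (b ∷ v)))
  go []       = 𝕡.refl {[]}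
  go (b ∷ bs) = begin
    ∑ (map (b ∷_) (extensions b n) ++ rest) f
      ≈⟨ ∑-++ (map (b ∷_) (extensions b n)) rest f ⟩
    ∑ (map (b ∷_) (extensions b n)) f 𝕡.+ ∑ rest f
      ≡⟨ ≡.cong (λ fs → sumᴿ fs 𝕡.+ ∑ rest f) (map-∘ (extensions b n)) ⟨
    ∑ (extensions b n) (λ v → f (b ∷ v)) 𝕡.+ ∑ rest f
      ≈⟨ 𝕡.+-congˡ {∑ (extensions b n) (λ v → f (b ∷ v))} (go bs) ⟩
    ∑ (b ∷ bs) (λ b → ∑ (extensions b n) (λ v → f (b ∷ v))) ∎
    where
    open ≈-Reasoning 𝕡.setoid
    rest = concatMap (λ b → map (b ∷_) (extensions b n)) bs

-- Words containing the pattern weigh zero, so sums may run over all of `extensions`, which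
-- decompose by their first letter, instead of over a filtered list.
weight : Word → Poly
weight w = if does (contains? _≟_ _≢?_ w) then [] else y^ des w

∑-avoiding : ∀ ws → ∑ (filter (λ w → ¬? (contains? _≟_ _≢?_ w)) ws) (λ w → y^ des w) 𝕡.≈ ∑ ws weight
∑-avoiding []       = 𝕡.refl {[]}
∑-avoiding (w ∷ ws) with does (contains? _≟_ _≢?_ w)
... | true  = ∑-avoiding ws
... | false = 𝕡.+-congˡ {y^ des w} (∑-avoiding ws)

-- One more descent prefixes a zero to the power of y, whereas the recurrence multiplies by y.
shift≈y^1* : ∀ p → (0ℤ ∷ p) 𝕡.≈ ((y^ 1) 𝕡.* p)
shift≈y^1* p k = ≡.sym (begin
  coeff ((y^ 1) *ᵖ p) k                                    ≡⟨ coeff-+ᵖ (map (0ℤ ℤ.*_) p) _ k ⟩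
  coeff (map (0ℤ ℤ.*_) p) k ℤ.+ coeff (0ℤ ∷ 1p) k          ≡⟨ ≡.cong (ℤ._+ coeff (0ℤ ∷ 1p) k) (coeff-map ≡.refl p k) ⟩
  0ℤ ℤ.* coeff p k ℤ.+ coeff (0ℤ ∷ 1p) k                   ≡⟨ ℤ.+-identityˡ _ ⟩
  coeff (0ℤ ∷ 1p) k                                        ≡⟨ tail k ⟩
  coeff (0ℤ ∷ p) k                                         ∎)
  where
  open ≡.≡-Reasoning
  1p = (y^ 0) *ᵖ p
  tail : ∀ k → coeff (0ℤ ∷ 1p) k ≡ coeff (0ℤ ∷ p) k
  tail zero    = ≡.refl
  tail (suc k) = 𝕡.*-identityˡ p k

-- An occurrence at the first position would force its first two letters to agree.
does-contains-≢ : ∀ {a b} v → a ≢ b →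
  does (contains? _≟_ _≢?_ (a ∷ b ∷ v)) ≡ does (contains? _≟_ _≢?_ (b ∷ v))
does-contains-≢ {a} {b} v a≢b =
  does-⇔ (mk⇔ drop there) (contains? _≟_ _≢?_ (a ∷ b ∷ v)) (contains? _≟_ _≢?_ (b ∷ v))
  where
  drop : Contains _≡_ _≢_ (a ∷ b ∷ v) → Contains _≡_ _≢_ (b ∷ v)
  drop (here a≡b _) = contradiction a≡b a≢b
  drop (there c)    = c

-- An occurrence at the first position would force the second and third letters to differ.
does-contains-≡ : ∀ a v →
  does (contains? _≟_ _≢?_ (a ∷ a ∷ a ∷ v)) ≡ does (contains? _≟_ _≢?_ (a ∷ a ∷ v))
does-contains-≡ a v =
  does-⇔ (mk⇔ drop there) (contains? _≟_ _≢?_ (a ∷ a ∷ a ∷ v)) (contains? _≟_ _≢?_ (a ∷ a ∷ v))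
  where
  drop : Contains _≡_ _≢_ (a ∷ a ∷ a ∷ v) → Contains _≡_ _≢_ (a ∷ a ∷ v)
  drop (here _ a≢a) = contradiction ≡.refl a≢a
  drop (there c)    = c

weight-level-change : ∀ a {c} v → a ≢ c → weight (a ∷ a ∷ c ∷ v) ≡ []
weight-level-change a {c} v a≢c
  rewrite dec-true (contains? _≟_ _≢?_ (a ∷ a ∷ c ∷ v)) (here ≡.refl a≢c) = ≡.refl

weight-level : ∀ a v → weight (a ∷ a ∷ a ∷ v) ≡ weight (a ∷ a ∷ v)
weight-level a v rewrite does-contains-≡ a v | dec-false (a <? a) (<-irrefl ≡.refl) = ≡.refl

weight-ascent : ∀ {a b} v → a < b → weight (a ∷ b ∷ v) ≡ weight (b ∷ v)
weight-ascent {a} {b} v a<b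
  rewrite does-contains-≢ v (<⇒≢ a<b) | dec-false (b <? a) (<-asym a<b) = ≡.refl

weight-descent : ∀ {a b} v → b < a → weight (a ∷ b ∷ v) 𝕡.≈ ((y^ 1) 𝕡.* weight (b ∷ v))
weight-descent {a} {b} v b<a
  rewrite does-contains-≢ v (≢-sym (<⇒≢ b<a)) | dec-true (b <? a) b<a
  with does (contains? _≟_ _≢?_ (b ∷ v))
... | true  = 𝕡.sym {(y^ 1) 𝕡.* []} {[]} (𝕡.zeroʳ (y^ 1))
... | false = shift≈y^1* (y^ des (b ∷ v))

-- The recurrence by the second letter: descent, level or ascent

∑-upTo-split : ∀ a f → ∑ (upTo (2 ℕ.+ a)) f 𝕡.≈ (∑ (upTo a) f 𝕡.+ (f a 𝕡.+ f (suc a)))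
∑-upTo-split a f = begin
  ∑ (upTo (2 ℕ.+ a)) f                   ≈⟨ ∑-upTo-suc (suc a) f ⟩
  ∑ (upTo (suc a)) f 𝕡.+ f (suc a)       ≈⟨ 𝕡.+-congʳ {f (suc a)} {∑ (upTo (suc a)) f} {∑ (upTo a) f 𝕡.+ f a} (∑-upTo-suc a f) ⟩
  ∑ (upTo a) f 𝕡.+ f a 𝕡.+ f (suc a)     ≈⟨ 𝕡.+-assoc (∑ (upTo a) f) (f a) (f (suc a)) ⟩
  ∑ (upTo a) f 𝕡.+ (f a 𝕡.+ f (suc a))   ∎
  where open ≈-Reasoning 𝕡.setoid

∑-zero-upTo : ∀ m {f} → (∀ b → b < m → f b 𝕡.≈ []) → ∑ (upTo m) f 𝕡.≈ []
∑-zero-upTo m {f} f≈0 = begin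
  ∑ (upTo m) f           ≈⟨ ∑-upTo-cong m f≈0 ⟩
  ∑ (upTo m) (λ _ → [])  ≈⟨ ∑-zero (upTo m) (λ _ → 𝕡.refl {[]}) ⟩
  []                     ∎
  where open ≈-Reasoning 𝕡.setoid

-- After two equal letters any different letter completes the pattern. Only the constant
-- continuation survives, and it has no descents.
∑-level : ∀ a n → ∑ (extensions a n) (λ v → weight (a ∷ a ∷ v)) 𝕡.≈ 𝕡.1#
∑-level a zero rewrite dec-false (a <? a) (<-irrefl ≡.refl) = 𝕡.refl {𝕡.1#}
∑-level a (suc n) = begin
  ∑ (extensions a (suc n)) (λ v → weight (a ∷ a ∷ v))
    ≈⟨ ∑-extensions a n (λ v → weight (a ∷ a ∷ v)) ⟩
  ∑ (upTo (2 ℕ.+ a)) next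
    ≈⟨ ∑-upTo-split a next ⟩
  ∑ (upTo a) next 𝕡.+ (next a 𝕡.+ next (suc a))
    ≈⟨ 𝕡.+-cong {∑ (upTo a) next} {[]} {next a 𝕡.+ next (suc a)} {𝕡.1# 𝕡.+ []}
         (∑-zero-upTo a (λ b b<a → change (≢-sym (<⇒≢ b<a))))
         (𝕡.+-cong {next a} {𝕡.1#} {next (suc a)} {[]} level (change (<⇒≢ ≤-refl))) ⟩
  𝕡.1# ∎
  where
  open ≈-Reasoning 𝕡.setoid
  next : ℕ → Poly
  next b = ∑ (extensions b n) (λ v → weight (a ∷ a ∷ b ∷ v))
  change : ∀ {b} → a ≢ b → next b 𝕡.≈ []
  change {b} a≢b = ∑-zero (extensions b n) (λ v → 𝕡.reflexive (weight-level-change a v a≢b))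
  level : next a 𝕡.≈ 𝕡.1#
  level = begin
    next a                                           ≈⟨ ∑-cong (extensions a n) (λ v → 𝕡.reflexive (weight-level a v)) ⟩
    ∑ (extensions a n) (λ v → weight (a ∷ a ∷ v))    ≈⟨ ∑-level a n ⟩
    𝕡.1#                                             ∎

G : ℕ → Series
G a n = ∑ (extensions a n) (λ v → weight (a ∷ v))

∑G : ℕ → Series
∑G a n = ∑ (upTo a) (λ b → G b n)

G-suc : ∀ a n → G a (suc n) 𝕡.≈ ((y^ 1) 𝕡.* ∑G a n 𝕡.+ (𝕡.1# 𝕡.+ G (suc a) n))
G-suc a n = begin
  G a (suc n)
    ≈⟨ ∑-extensions a n (λ v → weight (a ∷ v)) ⟩
  ∑ (upTo (2 ℕ.+ a)) next
    ≈⟨ ∑-upTo-split a next ⟩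
  ∑ (upTo a) next 𝕡.+ (next a 𝕡.+ next (suc a))
    ≈⟨ 𝕡.+-cong {∑ (upTo a) next} {(y^ 1) 𝕡.* ∑G a n} {next a 𝕡.+ next (suc a)} {𝕡.1# 𝕡.+ G (suc a) n}
         descents (𝕡.+-cong {next a} {𝕡.1#} {next (suc a)} {G (suc a) n} (∑-level a n) ascent) ⟩
  (y^ 1) 𝕡.* ∑G a n 𝕡.+ (𝕡.1# 𝕡.+ G (suc a) n) ∎
  where
  open ≈-Reasoning 𝕡.setoid
  next : ℕ → Poly
  next b = ∑ (extensions b n) (λ v → weight (a ∷ b ∷ v))
  ascent : next (suc a) 𝕡.≈ G (suc a) n
  ascent = ∑-cong (extensions (suc a) n) (λ v → 𝕡.reflexive (weight-ascent v ≤-refl))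
  descents : ∑ (upTo a) next 𝕡.≈ ((y^ 1) 𝕡.* ∑G a n)
  descents = begin
    ∑ (upTo a) next
      ≈⟨ ∑-upTo-cong a descent ⟩
    ∑ (upTo a) (λ b → (y^ 1) 𝕡.* G b n)
      ≈⟨ ∑-*ˡ (y^ 1) (upTo a) (λ b → G b n) ⟩
    (y^ 1) 𝕡.* ∑G a n ∎
    where
    descent : ∀ b → b < a → next b 𝕡.≈ ((y^ 1) 𝕡.* G b n)
    descent b b<a = begin
      next b                                                    ≈⟨ ∑-cong (extensions b n) (λ v → weight-descent v b<a) ⟩
      ∑ (extensions b n) (λ v → (y^ 1) 𝕡.* weight (b ∷ v))      ≈⟨ ∑-*ˡ (y^ 1) (extensions b n) (λ v → weight (b ∷ v)) ⟩
      (y^ 1) 𝕡.* G b n                                          ∎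

C-suc : ∀ n → C _≟_ _≢?_ (suc n) 𝕡.≈ G 0 n
C-suc n = begin
  C _≟_ _≢?_ (suc n)                        ≈⟨ ∑-avoiding (catalanWords (suc n)) ⟩
  ∑ (map (0 ∷_) (extensions 0 n)) weight    ≡⟨ ≡.cong sumᴿ (map-∘ (extensions 0 n)) ⟨
  G 0 n                                     ∎
  where open ≈-Reasoning 𝕡.setoid

-- The recurrences as identities of power series

private
  module 𝕊 = PowerSeriesRing ℤ[y]-commutativeRing

-- This is 1/(1 - x): one constant continuation for each length.
geometric : Series
geometric _ = 𝕡.1#

-- Removing the first remaining letter lowers the length by one; this turns such coefficient
-- recurrences into series equations with a factor `x`.
unshift : ∀ F F′ → F 0 𝕡.≈ 𝕡.1# → (∀ n → F (suc n) 𝕡.≈ F′ n) → F ≈ 1# + x * F′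
unshift F F′ F₀ F-suc zero    = begin
  F 0                      ≈⟨ F₀ ⟩
  𝕡.1#                     ≈⟨ 𝕡.+-identityʳ 𝕡.1# ⟨
  𝕡.1# 𝕡.+ []              ≈⟨ 𝕡.+-congˡ {𝕡.1#} {(x * F′) 0} {[]} (𝕊.indeterminate*-zero F′) ⟨
  𝕡.1# 𝕡.+ (x * F′) 0      ∎
  where open ≈-Reasoning 𝕡.setoid
unshift F F′ F₀ F-suc (suc n) = begin
  F (suc n)                ≈⟨ F-suc n ⟩
  F′ n                     ≈⟨ 𝕊.indeterminate*-suc F′ n ⟨
  (x * F′) (suc n)         ∎
  where open ≈-Reasoning 𝕡.setoid

G-step : ∀ a → G a ≈ 1# + x * (y * ∑G a + (geometric + G (suc a)))
G-step a = unshift (G a) (y * ∑G a + (geometric + G (suc a))) (𝕡.refl {𝕡.1#}) (λ n → begin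
  G a (suc n)
    ≈⟨ G-suc a n ⟩
  (y^ 1) 𝕡.* ∑G a n 𝕡.+ (𝕡.1# 𝕡.+ G (suc a) n)
    ≈⟨ 𝕡.+-congʳ {𝕡.1# 𝕡.+ G (suc a) n} {(y * ∑G a) n} {(y^ 1) 𝕡.* ∑G a n} (𝕊.constant* (y^ 1) (∑G a) n) ⟨
  (y * ∑G a + (geometric + G (suc a))) n ∎)
  where open ≈-Reasoning 𝕡.setoid

geometric-step : geometric ≈ 1# + x * geometric
geometric-step = unshift geometric geometric (𝕡.refl {𝕡.1#}) (λ _ → 𝕡.refl {𝕡.1#})

∑G-zero : ∑G 0 ≈ 0#
∑G-zero zero    = 𝕡.refl {[]}
∑G-zero (suc _) = 𝕡.refl {[]}

∑G-suc : ∀ a → ∑G (suc a) ≈ ∑G a + G a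
∑G-suc a n = ∑-upTo-suc a (λ b → G b n)

C-step : C _≟_ _≢?_ ≈ 1# + x * G 0
C-step = unshift (C _≟_ _≢?_) (G 0) (𝕡.refl {𝕡.1#}) C-suc

private
  module Solved = KernelMethod.Solution 𝕊.commutativeRing x y 𝕊.x-adically-separated
    G ∑G geometric (C _≟_ _≢?_) geometric-step ∑G-zero ∑G-suc G-step C-step

-- Uniqueness of the square root

i+i≡0⇒i≡0 : ∀ i → i ℤ.+ i ≡ 0ℤ → i ≡ 0ℤ
i+i≡0⇒i≡0 (ℤ.+ zero)    _ = ≡.refl
i+i≡0⇒i≡0 (ℤ.+ suc _)   ()
i+i≡0⇒i≡0 ℤ.-[1+ _ ]    ()

-- The integers have no 2-torsion, and this passes to each coefficient. The element `u` stands for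
-- the constant term of a sum of two square roots, known to be 2 only up to equality of
-- coefficients.
2-regular : ∀ {u} → u 𝕡.≈ (𝕡.1# 𝕡.+ 𝕡.1#) → ∀ p → (p 𝕡.* u) 𝕡.≈ [] → p 𝕡.≈ []
2-regular {u} u≈2 p pu≈0 k = i+i≡0⇒i≡0 (coeff p k) (≡.trans (≡.sym (coeff-+ᵖ p p k)) (p+p≈0 k))
  where
  open ≈-Reasoning 𝕡.setoid
  p+p≈0 : (p 𝕡.+ p) 𝕡.≈ []
  p+p≈0 = begin
    p 𝕡.+ p                     ≈⟨ 𝕡.+-cong {p 𝕡.* 𝕡.1#} {p} {p 𝕡.* 𝕡.1#} {p} (𝕡.*-identityʳ p) (𝕡.*-identityʳ p) ⟨
    p 𝕡.* 𝕡.1# 𝕡.+ p 𝕡.* 𝕡.1#   ≈⟨ 𝕡.distribˡ p 𝕡.1# 𝕡.1# ⟨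
    p 𝕡.* (𝕡.1# 𝕡.+ 𝕡.1#)       ≈⟨ 𝕡.*-congˡ {p} {u} {𝕡.1# 𝕡.+ 𝕡.1#} u≈2 ⟨
    p 𝕡.* u                     ≈⟨ pu≈0 ⟩
    []                          ∎

-- The product (S - T)(S + T) vanishes, and S + T has constant term 2, which is regular, so S - T is
-- zero.
isSqrt-unique : ∀ {P S T} → IsSqrt P S → IsSqrt P T → S ≈ T
isSqrt-unique {P} {S} {T} isS isT n =
  x∙y⁻¹≈ε⇒x≈y (S n) (T n) (𝕊.nonZeroDivisor {S + T}
    (2-regular {(S + T) 0} (𝕡.+-cong {S 0} {𝕡.1#} {T 0} {𝕡.1#} isS.constantTerm isT.constantTerm))
    (S - T) product≈0 n)
  where
  module isS = IsSqrt isS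
  module isT = IsSqrt isT
  open GroupProperties 𝕡.+-group
  product≈0 : ∀ n → ((S - T) * (S + T)) n 𝕡.≈ []
  product≈0 n = 𝕡.trans {((S - T) * (S + T)) n} {0# n} {[]}
    (difference-of-squares 𝕊.commutativeRing S T
      (λ m → 𝕡.trans {(S * S) m} {P m} {(T * T) m} (isS.square m) (𝕡.sym {(T * T) m} {P m} (isT.square m))) n)
    (𝕊.0#-at n)

-- Existence and uniqueness of the root show that the formula, quantified over square roots, is not
-- vacuous and speaks of a single series. The denominator is cleared.
theorem3p10 : let P = 1# - 2# * x + x * x - 4# * (x * x) * y in
    ∃! _≈_ (IsSqrt P) ×
    (∀ √P → IsSqrt P √P →
    (2# * x * y * (1# - x)) * C _≟_ _≢?_
    ≈ 1# - x + 2# * x * y - 2# * (x * x) * y - √P)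
theorem3p10 = (Solved.root , root-isSqrt , isSqrt-unique root-isSqrt)
            , λ √P isSqrt → Solved.closed-form √P (isSqrt-unique root-isSqrt isSqrt)
  where
  root-isSqrt : IsSqrt (1# - 2# * x + x * x - 4# * (x * x) * y) Solved.root
  -- Every summand of the root other than 1 carries a factor x, so the constant term computes to 1.
  root-isSqrt = record { constantTerm = λ _ → ≡.refl ; square = Solved.root-square }
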